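{- Let $\sigma\in A^u$. For all $P,Q\in C_{\alpha(\sigma)}$, $P=_{sse,\sigma}Q$ if and only if $P=_{sbf,\sigma}Q$; that is, $sse_\sigma(P)=sse_\sigma(Q)$ if and only if $sbf_\sigma(P)=sbf_\sigma(Q)$.
   Context: Let $A$ be a countable set (of atoms) with at least two elements. For $A'\subseteq A$, $C_{A'}$ is the set of closed terms (conditional statements) over the signature with constants $T$, $F$, a constant $a$ for each $a\in A'$, and one ternary operation $x\triangleleft y\triangleright z$ (the conditional, "if $y$ then $x$ else $z$"). Evaluation trees: the set $\mathcal T_A$ is defined inductively by $T\in\mathcal T_A$, $F\in\mathcal T_A$, and $(X\trianglelefteq a\trianglerighteq Y)\in\mathcal T_A$ for all $X,Y\in\mathcal T_A$, $a\in A$ (binary tree with root $a$, left branch $X$, right branch $Y$). Leaf replacement: for $Y,Z\in\mathcal T_A$, $X[T\mapsto Y,F\mapsto Z]$ is defined by $T[T\mapsto Y,F\mapsto Z]=Y$, $F[T\mapsto Y,F\mapsto Z]=Z$, $(X_1\trianglelefteq a\trianglerighteq X_2)[T\mapsto Y,F\mapsto Z]=X_1[T\mapsto Y,F\mapsto Z]\trianglelefteq a\trianglerighteq X_2[T\mapsto Y,F\mapsto Z]$. The short-circuit evaluation function $se:C_A\to\mathcal T_A$ is defined by $se(T)=T$, $se(F)=F$, $se(a)=T\trianglelefteq a\trianglerighteq F$ for $a\in A$, and $se(P\triangleleft Q\triangleright R)=se(Q)[T\mapsto se(P),F\mapsto se(R)]$. Memorizing evaluation trees: for $a\in A$ define $L_a,R_a:\mathcal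 T_A\to\mathcal T_A$ by $L_a(B)=R_a(B)=B$ for $B\in\{T,F\}$; $L_a(X\trianglelefteq a\trianglerighteq Y)=L_a(X)$; $R_a(X\trianglelefteq a\trianglerighteq Y)=R_a(Y)$; and, if $b\neq a$, $L_a(X\trianglelefteq b\trianglerighteq Y)=L_a(X)\trianglelefteq b\trianglerighteq L_a(Y)$ and $R_a(X\trianglelefteq b\trianglerighteq Y)=R_a(X)\trianglelefteq b\trianglerighteq R_a(Y)$. Define $m:\mathcal T_A\to\mathcal T_A$ (by recursion on depth) by $m(T)=T$, $m(F)=F$, $m(X\trianglelefteq a\trianglerighteq Y)=m(L_a(X))\trianglelefteq a\trianglerighteq m(R_a(Y))$, and $mse(P)=m(se(P))$ for $P\in C_A$. Basic forms: $BF_A\subseteq C_A$ is given by the grammar $t::=T\mid F\mid t\triangleleft a\triangleright t$ ($a\in A$). For $P,Q,R\in BF_A$, $P[T\mapsto Q,F\mapsto R]\in BF_A$ is obtained by replacing all occurrences of $T$ in $P$ by $Q$ and all occurrences of $F$ in $P$ by $R$ (simultaneously). The basic form function $bf:C_A\to BF_A$ is defined by $bf(T)=T$, $bf(F)=F$, $bf(a)=T\triangleleft a\triangleright F$ for $a\in A$, $bf(P\triangleleft Q\triangleright R)=bf(Q)[T\mapsto bf(P),F\mapsto bf(R)]$. The function $mbf$: for $a\in A$ define $\ell_a,r_a:BF_A\to BF_A$ by $\ell_a(B)=r_a(B)=B$ for $B\in\{T,F\}$; $\ell_a(P\triangleleft a\triangleright Q)=\ell_a(P)$; $r_a(P\triangleleft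 a\triangleright Q)=r_a(Q)$; and, if $b\neq a$, $\ell_a(P\triangleleft b\triangleright Q)=\ell_a(P)\triangleleft b\triangleright \ell_a(Q)$ and $r_a(P\triangleleft b\triangleright Q)=r_a(P)\triangleleft b\triangleright r_a(Q)$. Define $mf:BF_A\to BF_A$ (by recursion on depth) by $mf(T)=T$, $mf(F)=F$, $mf(P\triangleleft a\triangleright Q)=mf(\ell_a(P))\triangleleft a\triangleright mf(r_a(Q))$, and $mbf(P)=mf(bf(P))$ for $P\in C_A$. Static versions: $A^u\subset A^*$ is the set of finite strings over $A$ (including the empty string $\epsilon$) containing no multiple occurrences of the same atom. $\alpha(\sigma)\subseteq A$ is the set of atoms occurring in $\sigma\in A^u$. For $\sigma\in A^u$ the conditional statement $E^\sigma$ is defined by $E^\epsilon=F$ and $E^{\rho a}=E^\rho\triangleleft a\triangleright E^\rho$. For $P\in C_{\alpha(\sigma)}$: $sse_\sigma(P)=mse(T\triangleleft E^\sigma\triangleright P)$ and $sbf_\sigma(P)=mbf(T\triangleleft E^\sigma\triangleright P)$. On $C_{\alpha(\sigma)}$: $P=_{sse,\sigma}Q$ iff $sse_\sigma(P)=sse_\sigma(Q)$; $P=_{sbf,\sigma}Q$ iff $sbf_\sigma(P)=sbf_\sigma(Q)$ (syntactic equality). -}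

module Defs where

open import Level using (Level; _⊔_)
open import Data.List.Base using (List; _∷ʳ_; foldl)
open import Data.List.Membership.Propositional using (_∈_)
open import Data.List.Properties using (foldl-∷ʳ)
open import Data.Nat.Base as ℕ using (ℕ; suc; _≤_; _<_; s≤s; z≤n)
open import Data.Nat.Induction using (<-wellFounded)
import Data.Nat.Properties as ℕₚ
open import Function.Bundles using (_↣_)
open import Induction.WellFounded using (Acc; acc)
open import Relation.Binary.Definitions using (DecidableEquality)
open import Relation.Binary.PropositionalEquality using (_≡_; refl; cong₂)
open import Relation.Nullary.Decidable.Core using (yes; no)
open import Relation.Nullary.Decidable using (via-injection)
open import Relation.Unary using (Pred)

private
  variable
    a p : Level

-- Cond A is the set C_A of all closed terms over the atoms A.
-- P ◁ Q ▷ R reads "if Q then P else R".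
data Cond (A : Set a) : Set a where
  T F   : Cond A
  atom  : A → Cond A
  _◁_▷_ : Cond A → Cond A → Cond A → Cond A

-- C[ A′ ] is the set C_{A′} for A′ ⊆ A, as a subset of C_A.
data C[_] {A : Set a} (A′ : Pred A p) : Pred (Cond A) (a ⊔ p) where
  T     : C[ A′ ] T
  F     : C[ A′ ] F
  atom  : ∀ {x} → A′ x → C[ A′ ] (atom x)
  _◁_▷_ : ∀ {P Q R} → C[ A′ ] P → C[ A′ ] Q → C[ A′ ] R → C[ A′ ] (P ◁ Q ▷ R)

-- X ⊴ x ⊵ Y has root x, left (true) branch X and right (false) branch Y.
data Tree (A : Set a) : Set a where
  T F   : Tree A
  _⊴_⊵_ : Tree A → A → Tree A → Tree A

data BF (A : Set a) : Set a where
  T F   : BF A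
  _◁_▷_ : BF A → A → BF A → BF A

-- The inclusion BF_A ⊆ C_A.
⌜_⌝ : {A : Set a} → BF A → Cond A
⌜ T ⌝         = T
⌜ F ⌝         = F
⌜ P ◁ x ▷ Q ⌝ = ⌜ P ⌝ ◁ atom x ▷ ⌜ Q ⌝

module _ {A : Set a} where

  _[T↦_,F↦_] : Tree A → Tree A → Tree A → Tree A
  T           [T↦ Y ,F↦ Z ] = Y
  F           [T↦ Y ,F↦ Z ] = Z
  (X ⊴ x ⊵ W) [T↦ Y ,F↦ Z ] = (X [T↦ Y ,F↦ Z ]) ⊴ x ⊵ (W [T↦ Y ,F↦ Z ])

  se : Cond A → Tree A
  se T           = T
  se F           = F
  se (atom x)    = T ⊴ x ⊵ F
  se (P ◁ Q ▷ R) = se Q [T↦ se P ,F↦ se R ]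

  _[T↦_,F↦_]ᵇ : BF A → BF A → BF A → BF A
  T           [T↦ Q ,F↦ R ]ᵇ = Q
  F           [T↦ Q ,F↦ R ]ᵇ = R
  (P ◁ x ▷ S) [T↦ Q ,F↦ R ]ᵇ = (P [T↦ Q ,F↦ R ]ᵇ) ◁ x ▷ (S [T↦ Q ,F↦ R ]ᵇ)

  bf : Cond A → BF A
  bf T           = T
  bf F           = F
  bf (atom x)    = T ◁ x ▷ F
  bf (P ◁ Q ▷ R) = bf Q [T↦ bf P ,F↦ bf R ]ᵇ

  depth : Tree A → ℕ
  depth T           = 0
  depth F           = 0
  depth (X ⊴ _ ⊵ Y) = suc (depth X ℕ.⊔ depth Y)

  depthᵇ : BF A → ℕ
  depthᵇ T           = 0
  depthᵇ F           = 0
  depthᵇ (P ◁ _ ▷ Q) = suc (depthᵇ P ℕ.⊔ depthᵇ Q)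

  α : List A → Pred A a
  α σ x = x ∈ σ

  -- A left fold, because the recursion removes the last atom of the string:
  -- see E-snoc.
  E : List A → Cond A
  E = foldl (λ P x → P ◁ atom x ▷ P) F

  E-snoc : ∀ ρ x → E (ρ ∷ʳ x) ≡ E ρ ◁ atom x ▷ E ρ
  E-snoc ρ x = foldl-∷ʳ (λ P y → P ◁ atom y ▷ P) F x ρ

-- An injection into ℕ (A is finite or countably infinite) decides equality
-- of atoms, which L, R, ℓ and r need.
atom-≟ : {A : Set a} → A ↣ ℕ → DecidableEquality A
atom-≟ enum = via-injection enum ℕₚ._≟_

module Memorizing {A : Set a} (_≟_ : DecidableEquality A) where

  L R : A → Tree A → Tree A
  L x T = T
  L x F = F
  L x (X ⊴ y ⊵ Y) with x ≟ y
  ... | yes _ = L x X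
  ... | no  _ = L x X ⊴ y ⊵ L x Y
  R x T = T
  R x F = F
  R x (X ⊴ y ⊵ Y) with x ≟ y
  ... | yes _ = R x Y
  ... | no  _ = R x X ⊴ y ⊵ R x Y

  L-depth : ∀ x X → depth (L x X) ≤ depth X
  L-depth x T = z≤n
  L-depth x F = z≤n
  L-depth x (X ⊴ y ⊵ Y) with x ≟ y
  ... | yes _ = ℕₚ.m≤n⇒m≤1+n (ℕₚ.≤-trans (L-depth x X) (ℕₚ.m≤m⊔n _ _))
  ... | no  _ = s≤s (ℕₚ.⊔-mono-≤ (L-depth x X) (L-depth x Y))

  R-depth : ∀ x X → depth (R x X) ≤ depth X
  R-depth x T = z≤n
  R-depth x F = z≤n
  R-depth x (X ⊴ y ⊵ Y) with x ≟ y
  ... | yes _ = ℕₚ.m≤n⇒m≤1+n (ℕₚ.≤-trans (R-depth x Y) (ℕₚ.m≤n⊔m (depth X) _))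
  ... | no  _ = s≤s (ℕₚ.⊔-mono-≤ (R-depth x X) (R-depth x Y))

  L-depth< : ∀ x X Y → depth (L x X) < depth (X ⊴ x ⊵ Y)
  L-depth< x X Y = s≤s (ℕₚ.≤-trans (L-depth x X) (ℕₚ.m≤m⊔n _ _))

  R-depth< : ∀ x X Y → depth (R x Y) < depth (X ⊴ x ⊵ Y)
  R-depth< x X Y = s≤s (ℕₚ.≤-trans (R-depth x Y) (ℕₚ.m≤n⊔m (depth X) _))

  m-acc : ∀ X → Acc _<_ (depth X) → Tree A
  m-acc T           _         = T
  m-acc F           _         = F
  m-acc (X ⊴ x ⊵ Y) (acc rec) =
    m-acc (L x X) (rec (L-depth< x X Y)) ⊴ x ⊵ m-acc (R x Y) (rec (R-depth< x X Y))

  -- The recursive clause of m is m-node.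
  m : Tree A → Tree A
  m X = m-acc X (<-wellFounded (depth X))

  m-acc-irrelevant : ∀ X (u v : Acc _<_ (depth X)) → m-acc X u ≡ m-acc X v
  m-acc-irrelevant T           _       _       = refl
  m-acc-irrelevant F           _       _       = refl
  m-acc-irrelevant (X ⊴ x ⊵ Y) (acc u) (acc v) =
    cong₂ (_⊴ x ⊵_) (m-acc-irrelevant (L x X) (u (L-depth< x X Y)) (v (L-depth< x X Y)))
                    (m-acc-irrelevant (R x Y) (u (R-depth< x X Y)) (v (R-depth< x X Y)))

  m-node : ∀ X x Y → m (X ⊴ x ⊵ Y) ≡ m (L x X) ⊴ x ⊵ m (R x Y)
  m-node X x Y = cong₂ (_⊴ x ⊵_) (m-acc-irrelevant (L x X) _ _) (m-acc-irrelevant (R x Y) _ _)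

  mse : Cond A → Tree A
  mse P = m (se P)

  ℓ r : A → BF A → BF A
  ℓ x T = T
  ℓ x F = F
  ℓ x (P ◁ y ▷ Q) with x ≟ y
  ... | yes _ = ℓ x P
  ... | no  _ = ℓ x P ◁ y ▷ ℓ x Q
  r x T = T
  r x F = F
  r x (P ◁ y ▷ Q) with x ≟ y
  ... | yes _ = r x Q
  ... | no  _ = r x P ◁ y ▷ r x Q

  ℓ-depth : ∀ x P → depthᵇ (ℓ x P) ≤ depthᵇ P
  ℓ-depth x T = z≤n
  ℓ-depth x F = z≤n
  ℓ-depth x (P ◁ y ▷ Q) with x ≟ y
  ... | yes _ = ℕₚ.m≤n⇒m≤1+n (ℕₚ.≤-trans (ℓ-depth x P) (ℕₚ.m≤m⊔n _ _))
  ... | no  _ = s≤s (ℕₚ.⊔-mono-≤ (ℓ-depth x P) (ℓ-depth x Q))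

  r-depth : ∀ x P → depthᵇ (r x P) ≤ depthᵇ P
  r-depth x T = z≤n
  r-depth x F = z≤n
  r-depth x (P ◁ y ▷ Q) with x ≟ y
  ... | yes _ = ℕₚ.m≤n⇒m≤1+n (ℕₚ.≤-trans (r-depth x Q) (ℕₚ.m≤n⊔m (depthᵇ P) _))
  ... | no  _ = s≤s (ℕₚ.⊔-mono-≤ (r-depth x P) (r-depth x Q))

  ℓ-depth< : ∀ x P Q → depthᵇ (ℓ x P) < depthᵇ (P ◁ x ▷ Q)
  ℓ-depth< x P Q = s≤s (ℕₚ.≤-trans (ℓ-depth x P) (ℕₚ.m≤m⊔n _ _))

  r-depth< : ∀ x P Q → depthᵇ (r x Q) < depthᵇ (P ◁ x ▷ Q)
  r-depth< x P Q = s≤s (ℕₚ.≤-trans (r-depth x Q) (ℕₚ.m≤n⊔m (depthᵇ P) _))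

  mf-acc : ∀ P → Acc _<_ (depthᵇ P) → BF A
  mf-acc T           _         = T
  mf-acc F           _         = F
  mf-acc (P ◁ x ▷ Q) (acc rec) =
    mf-acc (ℓ x P) (rec (ℓ-depth< x P Q)) ◁ x ▷ mf-acc (r x Q) (rec (r-depth< x P Q))

  -- The recursive clause of mf is mf-node.
  mf : BF A → BF A
  mf P = mf-acc P (<-wellFounded (depthᵇ P))

  mf-acc-irrelevant : ∀ P (u v : Acc _<_ (depthᵇ P)) → mf-acc P u ≡ mf-acc P v
  mf-acc-irrelevant T           _       _       = refl
  mf-acc-irrelevant F           _       _       = refl
  mf-acc-irrelevant (P ◁ x ▷ Q) (acc u) (acc v) =
    cong₂ (_◁ x ▷_) (mf-acc-irrelevant (ℓ x P) (u (ℓ-depth< x P Q)) (v (ℓ-depth< x P Q)))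
                    (mf-acc-irrelevant (r x Q) (u (r-depth< x P Q)) (v (r-depth< x P Q)))

  mf-node : ∀ P x Q → mf (P ◁ x ▷ Q) ≡ mf (ℓ x P) ◁ x ▷ mf (r x Q)
  mf-node P x Q = cong₂ (_◁ x ▷_) (mf-acc-irrelevant (ℓ x P) _ _) (mf-acc-irrelevant (r x Q) _ _)

  mbf : Cond A → BF A
  mbf P = mf (bf P)

  sse : List A → Cond A → Tree A
  sse σ P = mse (T ◁ E σ ▷ P)

  sbf : List A → Cond A → BF A
  sbf σ P = mbf (T ◁ E σ ▷ P)

  -- sse, sbf and the two relations below are defined for every string σ and
  -- all of C_A; the intended domain is σ without repetitions and C[ α σ ].
  _=sse[_]_ : Cond A → List A → Cond A → Set a
  P =sse[ σ ] Q = sse σ P ≡ sse σ Q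

  -- Equality of basic forms as conditional statements, i.e. in C_A.
  _=sbf[_]_ : Cond A → List A → Cond A → Set a
  P =sbf[ σ ] Q = ⌜ sbf σ P ⌝ ≡ ⌜ sbf σ Q ⌝

{-# OPTIONS --safe #-}
-- Evaluation trees and basic forms are isomorphic: on basic forms se only
-- renames the constructors. Hence bf mirrors se and mf mirrors m, so that
-- se (mbf P) = mse P, and se is injective on basic forms.
module Submission where

open import Defs
open import Data.List.Base using (List)
open import Data.List.Relation.Unary.Unique.Propositional using (Unique)
open import Data.Nat.Base using (ℕ; _<_)
open import Data.Product.Base using (∃₂)
open import Function.Bundles using (_↣_; _⇔_; mk⇔)
open import Induction.WellFounded using (Acc; acc)
open import Relation.Binary.Definitions using (DecidableEquality)
open import Relation.Binary.PropositionalEquality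
  using (_≡_; _≢_; refl; sym; trans; cong; cong₂; module ≡-Reasoning)
open import Relation.Nullary.Decidable.Core using (yes; no)
open import Relation.Unary using (_∈_)

module _ {a} {A : Set a} where

  open ≡-Reasoning

  -- The values lie in `Cond A`, not `BF A`, because `_=sbf[_]_` compares basic forms there.
  fromTree : Tree A → Cond A
  fromTree T           = T
  fromTree F           = F
  fromTree (X ⊴ x ⊵ Y) = fromTree X ◁ atom x ▷ fromTree Y

  -- Since `se (atom x)` is `T ⊴ x ⊵ F`, leaf replacement computes: `se` of a node with atomic
  -- condition is definitionally a tree node.
  fromTree-se : ∀ (P : BF A) → fromTree (se ⌜ P ⌝) ≡ ⌜ P ⌝
  fromTree-se T           = refl
  fromTree-se F           = refl
  fromTree-se (P ◁ x ▷ Q) = cong₂ (_◁ atom x ▷_) (fromTree-se P) (fromTree-se Q)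

  se-injective : ∀ (P Q : BF A) → se ⌜ P ⌝ ≡ se ⌜ Q ⌝ → ⌜ P ⌝ ≡ ⌜ Q ⌝
  se-injective P Q eq = begin
    ⌜ P ⌝                ≡⟨ fromTree-se P ⟨
    fromTree (se ⌜ P ⌝)  ≡⟨ cong fromTree eq ⟩
    fromTree (se ⌜ Q ⌝)  ≡⟨ fromTree-se Q ⟩
    ⌜ Q ⌝                ∎

  se-[T↦,F↦] : ∀ (P Q R : BF A) →
    se ⌜ P [T↦ Q ,F↦ R ]ᵇ ⌝ ≡ se ⌜ P ⌝ [T↦ se ⌜ Q ⌝ ,F↦ se ⌜ R ⌝ ]
  se-[T↦,F↦] T           Q R = refl
  se-[T↦,F↦] F           Q R = refl
  se-[T↦,F↦] (P ◁ x ▷ S) Q R = cong₂ (_⊴ x ⊵_) (se-[T↦,F↦] P Q R) (se-[T↦,F↦] S Q R)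

  se-bf : ∀ (P : Cond A) → se ⌜ bf P ⌝ ≡ se P
  se-bf T           = refl
  se-bf F           = refl
  se-bf (atom x)    = refl
  se-bf (P ◁ Q ▷ R) = begin
    se ⌜ bf Q [T↦ bf P ,F↦ bf R ]ᵇ ⌝                   ≡⟨ se-[T↦,F↦] (bf Q) (bf P) (bf R) ⟩
    se ⌜ bf Q ⌝ [T↦ se ⌜ bf P ⌝ ,F↦ se ⌜ bf R ⌝ ]  ≡⟨ cong (_[T↦ _ ,F↦ _ ]) (se-bf Q) ⟩
    se Q [T↦ se ⌜ bf P ⌝ ,F↦ se ⌜ bf R ⌝ ]           ≡⟨ cong₂ (se Q [T↦_,F↦_]) (se-bf P) (se-bf R) ⟩
    se Q [T↦ se P ,F↦ se R ]                              ∎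

  module _ (_≟_ : DecidableEquality A) where

    open Memorizing _≟_

    -- Both functions branch on the same test `x ≟ y`, so one case split reduces both sides.
    L-se : ∀ x P → L x (se ⌜ P ⌝) ≡ se ⌜ ℓ x P ⌝
    L-se x T = refl
    L-se x F = refl
    L-se x (P ◁ y ▷ Q) with x ≟ y
    ... | yes _ = L-se x P
    ... | no  _ = cong₂ (_⊴ y ⊵_) (L-se x P) (L-se x Q)

    R-se : ∀ x P → R x (se ⌜ P ⌝) ≡ se ⌜ r x P ⌝
    R-se x T = refl
    R-se x F = refl
    R-se x (P ◁ y ▷ Q) with x ≟ y
    ... | yes _ = R-se x Q
    ... | no  _ = cong₂ (_⊴ y ⊵_) (R-se x P) (R-se x Q)

    -- X is kept apart from se ⌜ P ⌝ because the recursive calls have L x X and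
    -- R x X, which are only propositionally of that form.
    m-acc-se : ∀ {X} P (u : Acc _<_ (depth X)) (v : Acc _<_ (depthᵇ P)) →
      X ≡ se ⌜ P ⌝ → m-acc X u ≡ se ⌜ mf-acc P v ⌝
    m-acc-se T           _       _       refl = refl
    m-acc-se F           _       _       refl = refl
    m-acc-se (P ◁ x ▷ Q) (acc u) (acc v) refl =
      -- The underscores stand for the accessibility proofs that `m-acc` derives from `u`; the goal
      -- determines them.
      cong₂ (_⊴ x ⊵_) (m-acc-se (ℓ x P) _ (v (ℓ-depth< x P Q)) (L-se x P))
                      (m-acc-se (r x Q) _ (v (r-depth< x P Q)) (R-se x Q))

    mse≡se-mbf : ∀ P → mse P ≡ se ⌜ mbf P ⌝
    -- Here `X` is `se P`, so `m` and `mf` start from corresponding arguments.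
    mse≡se-mbf P = m-acc-se (bf P) _ _ (sym (se-bf P))

    sse⇒sbf : ∀ σ P Q → P =sse[ σ ] Q → P =sbf[ σ ] Q
    sse⇒sbf σ P Q eq = se-injective (sbf σ P) (sbf σ Q)
      (trans (sym (mse≡se-mbf (T ◁ E σ ▷ P))) (trans eq (mse≡se-mbf (T ◁ E σ ▷ Q))))

    -- Congruence of `se` takes the place that injectivity has in the converse.
    sbf⇒sse : ∀ σ P Q → P =sbf[ σ ] Q → P =sse[ σ ] Q
    sbf⇒sse σ P Q eq = trans (mse≡se-mbf (T ◁ E σ ▷ P))
      (trans (cong se eq) (sym (mse≡se-mbf (T ◁ E σ ▷ Q))))

proposition6p15 : ∀ {a} {A : Set a} (enum : A ↣ ℕ) → (∃₂ λ (x y : A) → x ≢ y) →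
    let open Memorizing (atom-≟ enum) in
    (σ : List A) → Unique σ →
    (P Q : Cond A) → P ∈ C[ α σ ] → Q ∈ C[ α σ ] →
    (P =sse[ σ ] Q) ⇔ (P =sbf[ σ ] Q)
proposition6p15 enum _ σ _ P Q _ _ =
  mk⇔ (sse⇒sbf (atom-≟ enum) σ P Q) (sbf⇒sse (atom-≟ enum) σ P Q)
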